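{- There exists an absolute constant $c'>0$ such that every finite simple graph $G$ with maximum degree $\Delta\ge 2$ satisfies $\mathrm{box}(G)<c'\Delta(\log\Delta)^2$.
   Context: The boxicity $\mathrm{box}(G)$ of a graph $G$ is the minimum integer $k$ such that the vertices can be mapped to axis-parallel boxes in $\mathbb{R}^k$ (products of $k$ closed intervals) with two vertices adjacent iff their boxes intersect; complete graphs have boxicity $0$. -}

module Defs where

open import Data.Nat using (ℕ; zero; suc; _+_; _*_; _^_; _≤_; _<_; _⊔_)
open import Data.Nat.Logarithm using (⌊log₂_⌋)
open import Data.Fin using (Fin)
open import Data.Bool using (Bool; true; false; if_then_else_)
open import Data.List using (List; map; foldr; allFin)
open import Data.Nat.ListAction using (sum)
open import Data.Product using (Σ; _×_; ∃-syntax)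
open import Relation.Binary.PropositionalEquality using (_≡_; _≢_)
open import Function.Bundles using (_⇔_)

record Graph (n : ℕ) : Set where
  field
    adj   : Fin n → Fin n → Bool
    sym   : ∀ u v → adj u v ≡ adj v u
    irrefl : ∀ v → adj v v ≡ false
open Graph public

degree : ∀ {n} → Graph n → Fin n → ℕ
degree {n} G v = sum (map (λ u → if adj G v u then 1 else 0) (allFin n))

maxDegree : ∀ {n} → Graph n → ℕ
maxDegree {n} G = foldr _⊔_ 0 (map (degree G) (allFin n))

-- A box representation of G in dimension k: vertex v gets the box
-- ∏_{i<k} [lo v i , hi v i]; distinct vertices are adjacent iff their
-- boxes intersect (i.e. the intervals intersect in every coordinate).
-- Endpoints are taken in ℕ (for finite graphs this is without loss of
-- generality: only the relative order of finitely many endpoints matters).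
record BoxRep {n : ℕ} (G : Graph n) (k : ℕ) : Set where
  field
    lo hi   : Fin n → Fin k → ℕ
    nonempty : ∀ v i → lo v i ≤ hi v i
    correct : ∀ u v → u ≢ v →
              (adj G u v ≡ true) ⇔ (∀ i → (lo u i ≤ hi v i) × (lo v i ≤ hi u i))

-- box(G) < b  iff  G has a box representation in some dimension k < b
-- (boxicity is the minimum such dimension).
BoxicityLessThan : ∀ {n} → Graph n → ℕ → Set
BoxicityLessThan G b = ∃[ k ] (k < b × BoxRep G k)

{-# OPTIONS --safe #-}
-- Any p : V → ℕ yields an interval supergraph of G: send v to the interval from p v to the
-- maximum of p over the closed neighbourhood N[v].  It separates a non-adjacent pair u, v as
-- soon as p v exceeds p on all of N[u], so it suffices to find O(Δ log² Δ) functions p such that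
-- every non-adjacent pair is separated by one of them.  With k = Θ(log Δ):
--   * a local-lemma argument splits V into O(Δ / k) parts meeting each N[u] in at most k vertices;
--   * colour the square of G with O(Δ²) colours, so that each N[u] is rainbow;
--   * by averaging, O(k log Δ) maps from colours to 2k hash values suffice to distinguish, for
--     every set S of at most k colours and every colour c, the value of c from those of S ∖ {c}.
-- For a part, a hash map and a hash value, rank the vertices of the part with that value along a
-- fixed order of V or its reverse, and let p be 0 elsewhere.  If v is not in N[u], then for the
-- part of v and a suitable hash map the only competitor of v in N[u] is the at most one vertex of
-- N[u] coloured like v, and one of the two directions ranks v above it.
module Submission where

open import Defs hiding (sym)
open import Algebra.Properties.CommutativeSemigroup using (interchange)
open import Data.Bool using (true; false; if_then_else_)
import Data.Bool.Properties as Bool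
open import Data.Fin using (Fin; zero; suc; toℕ; combine; remQuot)
import Data.Fin.Properties as Fin
open import Data.List as List using (List; []; _∷_; _++_; map; length; concatMap; allFin; filter; take; foldr)
open import Data.List.Properties using (length-map; length-++; length-tabulate; length-filter; length-take; map-++; map-∘; map-cong)
import Data.List.Membership.DecPropositional as DecMembership
open import Data.List.Membership.Propositional using (_∈_; _∉_; find)
open import Data.List.Membership.Propositional.Properties using (∈-map⁺; ∈-map⁻; ∈-++⁺ˡ; ∈-++⁺ʳ; ∈-++⁻; ∈-filter⁺; ∈-filter⁻; ∈-concatMap⁺; ∈-concatMap⁻; ∈-allFin)
open import Data.List.Relation.Binary.Sublist.Propositional as Sublist using ([]; _∷_; _∷ʳ_) renaming (_⊆_ to _⊑_)
open import Data.List.Relation.Binary.Sublist.Propositional.Properties using (All-resp-⊆; Any-resp-⊆; take-⊆; filter-⊆)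
open import Data.List.Relation.Binary.Subset.Propositional using (_⊆_)
open import Data.List.Relation.Unary.All as All using (All; []; _∷_)
open import Data.List.Relation.Unary.All.Properties using (all-filter)
open import Data.List.Relation.Unary.AllPairs using ([]; _∷_)
open import Data.List.Relation.Unary.Any as Any using (Any; here; there)
open import Data.List.Relation.Unary.Any.Properties using (lookup-index)
open import Data.List.Relation.Unary.Unique.Propositional using (Unique)
open import Data.List.Relation.Unary.Unique.Propositional.Properties using (allFin⁺; filter⁺)
open import Data.Nat using (ℕ; zero; suc; _+_; _*_; _∸_; _^_; _/_; _%_; _!; _⊔_; _≤_; _<_; z≤n; s≤s; z<s; NonZero; >-nonZero)
open import Data.Nat.DivMod using (m/n*n≤m; m*n/n≡m; m≡m%n+[m/n]*n; m%n<n; /-monoˡ-≤)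
open import Data.Nat.ListAction using (sum)
open import Data.Nat.ListAction.Properties using (sum-++)
open import Data.Nat.Logarithm using (⌊log₂_⌋; ⌊log₂⌋-mono-≤; ⌊log₂[2^n]⌋≡n)
open import Data.Nat.Properties
open import Data.Nat.Tactic.RingSolver using (solve-∀)
open import Data.Product using (_×_; _,_; proj₁; proj₂; map₂; ∃; ∃-syntax)
open import Data.Sum using (inj₁; inj₂)
open import Data.Unit using (⊤; tt)
open import Data.Vec using (Vec; []; _∷_; lookup; _[_]≔_)
open import Data.Vec.Properties using (lookup∘update; lookup∘update′)
open import Function using (_∘_; id; mk⇔)
open import Relation.Binary.Definitions using (tri<; tri≈; tri>)
open import Relation.Binary.PropositionalEquality hiding ([_])
open import Relation.Nullary using (¬_; Dec; yes; no; contradiction; _×-dec_; ¬?)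
open import Relation.Nullary.Decidable using (decidable-stable)
open import Relation.Unary using (Decidable)

private variable
  A B : Set
  P Q : Set
  m n : ℕ

-- Finite sums and counting

∑ : List A → (A → ℕ) → ℕ
∑ xs h = sum (map h xs)

∑-mono : ∀ (xs : List A) {g h : A → ℕ} → (∀ {x} → x ∈ xs → g x ≤ h x) → ∑ xs g ≤ ∑ xs h
∑-mono []       g≤h = z≤n
∑-mono (x ∷ xs) g≤h = +-mono-≤ (g≤h (here refl)) (∑-mono xs (g≤h ∘ there))

∑-cong : ∀ (xs : List A) {g h : A → ℕ} → (∀ x → g x ≡ h x) → ∑ xs g ≡ ∑ xs h
∑-cong xs g≡h = cong sum (map-cong g≡h xs)

∑-distrib-+ : ∀ (xs : List A) (g h : A → ℕ) → ∑ xs (λ x → g x + h x) ≡ ∑ xs g + ∑ xs h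
∑-distrib-+ []       g h = refl
∑-distrib-+ (x ∷ xs) g h =
  trans (cong (g x + h x +_) (∑-distrib-+ xs g h)) (interchange +-commutativeSemigroup (g x) (h x) _ _)

∑-distribʳ-* : ∀ (xs : List A) (h : A → ℕ) c → ∑ xs h * c ≡ ∑ xs (λ x → h x * c)
∑-distribʳ-* []       h c = refl
∑-distribʳ-* (x ∷ xs) h c =
  trans (*-distribʳ-+ c (h x) _) (cong (h x * c +_) (∑-distribʳ-* xs h c))

∑-const : ∀ (xs : List A) c → ∑ xs (λ _ → c) ≡ length xs * c
∑-const []       c = refl
∑-const (x ∷ xs) c = cong (c +_) (∑-const xs c)

∑-comm : ∀ (xs : List A) (ys : List B) (h : A → B → ℕ) →
         ∑ xs (λ x → ∑ ys (h x)) ≡ ∑ ys (λ y → ∑ xs (λ x → h x y))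
∑-comm []       ys h = sym (trans (∑-const ys 0) (*-zeroʳ (length ys)))
∑-comm (x ∷ xs) ys h =
  trans (cong (∑ ys (h x) +_) (∑-comm xs ys h)) (sym (∑-distrib-+ ys (h x) _))

∑-++ : ∀ (xs ys : List A) (h : A → ℕ) → ∑ (xs ++ ys) h ≡ ∑ xs h + ∑ ys h
∑-++ xs ys h = trans (cong sum (map-++ h xs ys)) (sum-++ (map h xs) (map h ys))

∑-concatMap : ∀ (k : A → List B) (xs : List A) (h : B → ℕ) →
              ∑ (concatMap k xs) h ≡ ∑ xs (λ x → ∑ (k x) h)
∑-concatMap k []       h = refl
∑-concatMap k (x ∷ xs) h =
  trans (∑-++ (k x) (concatMap k xs) h) (cong (∑ (k x) h +_) (∑-concatMap k xs h))

∈⇒≤∑ : ∀ {xs : List A} (h : A → ℕ) {x} → x ∈ xs → h x ≤ ∑ xs h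
∈⇒≤∑ h (here refl)  = m≤m+n _ _
∈⇒≤∑ h (there x∈xs) = ≤-trans (∈⇒≤∑ h x∈xs) (m≤n+m _ _)

∑>0⇒∃ : ∀ (xs : List A) (h : A → ℕ) → 0 < ∑ xs h → ∃[ x ] 0 < h x
∑>0⇒∃ (x ∷ xs) h 0<∑ with h x in eq
... | zero  = ∑>0⇒∃ xs h 0<∑
... | suc _ = x , subst (0 <_) (sym eq) z<s

-- If every value exceeded `b`, each would be at least `suc b` and the sum would reach
-- `length xs * suc b`.
∑-average : ∀ (xs : List A) (h : A → ℕ) b → ∑ xs h < length xs * suc b → ∃[ x ] h x ≤ b
∑-average (x ∷ xs) h b lt with h x ≤? b
... | yes hx≤b = x , hx≤b
... | no  hx≰b = ∑-average xs h b (≰⇒> λ le → <⇒≱ lt (+-mono-≤ (≰⇒> hx≰b) le))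

length-concatMap : ∀ (k : A → List B) (xs : List A) → length (concatMap k xs) ≡ ∑ xs (length ∘ k)
length-concatMap k []       = refl
length-concatMap k (x ∷ xs) =
  trans (length-++ (k x)) (cong (length (k x) +_) (length-concatMap k xs))

length-concatMap-≤ : ∀ (k : A → List B) (xs : List A) {a b} → length xs ≤ a →
                     (∀ x → length (k x) ≤ b) → length (concatMap k xs) ≤ a * b
length-concatMap-≤ k xs {a} {b} xs≤a k≤b = begin
  length (concatMap k xs) ≡⟨ length-concatMap k xs ⟩
  ∑ xs (length ∘ k)       ≤⟨ ∑-mono xs (λ {x} _ → k≤b x) ⟩
  ∑ xs (λ _ → b)          ≡⟨ ∑-const xs b ⟩
  length xs * b           ≤⟨ *-monoˡ-≤ b xs≤a ⟩
  a * b                   ∎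
  where open ≤-Reasoning

𝟙 : Dec P → ℕ
𝟙 (yes _) = 1
𝟙 (no  _) = 0

𝟙-mono : (P? : Dec P) (Q? : Dec Q) → (P → Q) → 𝟙 P? ≤ 𝟙 Q?
𝟙-mono (no _)  Q?       P→Q = z≤n
𝟙-mono (yes p) (yes _)  P→Q = ≤-refl
𝟙-mono (yes p) (no ¬q)  P→Q = contradiction (P→Q p) ¬q

𝟙-yes : (P? : Dec P) → P → 𝟙 P? ≡ 1
𝟙-yes (yes _) p = refl
𝟙-yes (no ¬p) p = contradiction p ¬p

𝟙>0 : (P? : Dec P) → 0 < 𝟙 P? → P
𝟙>0 (yes p) _ = p

∑-𝟙-≡-∉ : ∀ {xs : List (Fin n)} y → y ∉ xs → ∑ xs (λ x → 𝟙 (x Fin.≟ y)) ≡ 0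
∑-𝟙-≡-∉ {xs = []}     y y∉ = refl
∑-𝟙-≡-∉ {xs = x ∷ xs} y y∉ with x Fin.≟ y
... | yes refl = contradiction (here refl) y∉
... | no  _    = ∑-𝟙-≡-∉ y (y∉ ∘ there)

∑-𝟙-≡ : ∀ {xs : List (Fin n)} → Unique xs → ∀ y → ∑ xs (λ x → 𝟙 (x Fin.≟ y)) ≤ 1
∑-𝟙-≡ []                        y = z≤n
∑-𝟙-≡ {xs = x ∷ xs} (x∉ ∷ uniq) y with x Fin.≟ y
... | yes refl = ≤-reflexive (cong suc (∑-𝟙-≡-∉ y λ y∈ → All.lookup x∉ y∈ refl))
... | no  _    = ∑-𝟙-≡ uniq y

length-filter≡∑ : ∀ {P : A → Set} (P? : ∀ x → Dec (P x)) xs → length (filter P? xs) ≡ ∑ xs (λ x → 𝟙 (P? x))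
length-filter≡∑ P? []       = refl
length-filter≡∑ P? (x ∷ xs) with P? x
... | yes _ = cong suc (length-filter≡∑ P? xs)
... | no  _ = length-filter≡∑ P? xs

-- Uniformly random vectors

allVecs : ∀ m n → List (Vec (Fin m) n)
allVecs m zero    = [] ∷ []
allVecs m (suc n) = concatMap (λ a → map (a ∷_) (allVecs m n)) (allFin m)

∑-allVecs-suc : ∀ m n (h : Vec (Fin m) (suc n) → ℕ) →
                ∑ (allVecs m (suc n)) h ≡ ∑ (allFin m) (λ a → ∑ (allVecs m n) (λ f → h (a ∷ f)))
∑-allVecs-suc m n h = trans (∑-concatMap _ (allFin m) h)
  (∑-cong (allFin m) λ a → cong sum (sym (map-∘ (allVecs m n))))

length-allVecs : ∀ m n → length (allVecs m n) ≡ m ^ n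
length-allVecs m zero    = refl
length-allVecs m (suc n) = begin
  length (allVecs m (suc n))                                  ≡⟨ length-concatMap _ (allFin m) ⟩
  ∑ (allFin m) (λ a → length (map (a ∷_) (allVecs m n)))  ≡⟨ ∑-cong (allFin m) (λ a → trans (length-map (a ∷_) (allVecs m n)) (length-allVecs m n)) ⟩
  ∑ (allFin m) (λ _ → m ^ n)                                  ≡⟨ ∑-const (allFin m) _ ⟩
  length (allFin m) * m ^ n                                   ≡⟨ cong (_* m ^ n) (length-tabulate {n = m} id) ⟩
  m * m ^ n                                                   ∎
  where open ≡-Reasoning

∈-allVecs : ∀ (f : Vec (Fin m) n) → f ∈ allVecs m n
∈-allVecs []      = here refl
∈-allVecs {m} {suc n} (a ∷ f) = ∈-concatMap⁺ (λ b → map (b ∷_) (allVecs m n))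
  (Any.map (λ { refl → ∈-map⁺ (a ∷_) (∈-allVecs f) }) (∈-allFin a))

-- Overwriting one coordinate of a uniform vector by an independent uniform value leaves it uniform.
-- The factor `m` pays for the extra choice of `a`.
∑-resample : ∀ m n (w : Fin n) (h : Vec (Fin m) n → ℕ) →
             ∑ (allVecs m n) h * m ≡ ∑ (allVecs m n) (λ f → ∑ (allFin m) (λ a → h (f [ w ]≔ a)))
∑-resample m (suc n) zero h = begin
  ∑ (allVecs m (suc n)) h * m                                        ≡⟨ cong (_* m) (∑-allVecs-suc m n h) ⟩
  ∑ (allFin m) (λ a → ∑ (allVecs m n) (λ f → h (a ∷ f))) * m         ≡⟨ *-comm _ m ⟩
  m * ∑ (allFin m) (λ a → ∑ (allVecs m n) (λ f → h (a ∷ f)))         ≡⟨ cong (m *_) (∑-comm (allFin m) (allVecs m n) _) ⟩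
  m * s                                                              ≡⟨ cong (_* s) (sym (length-tabulate {n = m} id)) ⟩
  length (allFin m) * s                                              ≡⟨ sym (∑-const (allFin m) s) ⟩
  ∑ (allFin m) (λ _ → s)                                             ≡⟨ sym (∑-allVecs-suc m n _) ⟩
  ∑ (allVecs m (suc n)) (λ f → ∑ (allFin m) (λ a → h (f [ zero ]≔ a))) ∎
  where
  open ≡-Reasoning
  s = ∑ (allVecs m n) (λ f → ∑ (allFin m) (λ a → h (a ∷ f)))
∑-resample m (suc n) (suc w) h = begin
  ∑ (allVecs m (suc n)) h * m                                  ≡⟨ cong (_* m) (∑-allVecs-suc m n h) ⟩
  ∑ (allFin m) (λ b → ∑ (allVecs m n) (λ f → h (b ∷ f))) * m   ≡⟨ ∑-distribʳ-* (allFin m) _ m ⟩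
  ∑ (allFin m) (λ b → ∑ (allVecs m n) (λ f → h (b ∷ f)) * m)   ≡⟨ ∑-cong (allFin m) (λ b → ∑-resample m n w (λ f → h (b ∷ f))) ⟩
  ∑ (allFin m) (λ b → ∑ (allVecs m n) (λ f → ∑ (allFin m) (λ a → h (b ∷ (f [ w ]≔ a))))) ≡⟨ sym (∑-allVecs-suc m n _) ⟩
  ∑ (allVecs m (suc n)) (λ f → ∑ (allFin m) (λ a → h (f [ suc w ]≔ a))) ∎
  where open ≡-Reasoning

-- Counting vectors and collision bounds

count : {R : Vec (Fin m) n → Set} → Decidable R → ℕ
count {m} {n} R? = ∑ (allVecs m n) (λ f → 𝟙 (R? f))

count-mono : ∀ {R S : Vec (Fin m) n → Set} (R? : Decidable R) (S? : Decidable S) →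
             (∀ f → R f → S f) → count R? ≤ count S?
count-mono {m} {n} R? S? R⊆S = ∑-mono (allVecs m n) λ {f} _ → 𝟙-mono (R? f) (S? f) (R⊆S f)

count-full : ∀ {R : Vec (Fin m) n → Set} (R? : Decidable R) → (∀ f → R f) → count R? ≡ m ^ n
count-full {m} {n} R? full = begin
  count R?                     ≡⟨ ∑-cong (allVecs m n) (λ f → 𝟙-yes (R? f) (full f)) ⟩
  ∑ (allVecs m n) (λ _ → 1)    ≡⟨ ∑-const (allVecs m n) 1 ⟩
  length (allVecs m n) * 1     ≡⟨ *-identityʳ _ ⟩
  length (allVecs m n)         ≡⟨ length-allVecs m n ⟩
  m ^ n                        ∎
  where open ≡-Reasoning

count-empty : ∀ {R : Vec (Fin m) n → Set} (R? : Decidable R) → (∀ f → ¬ R f) → count R? ≡ 0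
count-empty {m} {n} R? empty = trans
  (∑-cong (allVecs m n) λ f → n≤0⇒n≡0 (𝟙-mono (R? f) (no (empty f)) id))
  (trans (∑-const (allVecs m n) 0) (*-zeroʳ (length (allVecs m n))))

-- One direction is enough: writing the old value back gives the converse, so `R` does not depend on
-- coordinate `w`.
Ignores : (Vec (Fin m) n → Set) → Fin n → Set
Ignores R w = ∀ f a → R (f [ w ]≔ a) → R f

-- Resample coordinate `w`: this affects neither `R` nor the value at `x`, and only one of the `m`
-- new values agrees with the latter. Given `R`, the agreement thus has probability at most 1/`m`,
-- stated without division.
collision : ∀ {R : Vec (Fin m) n → Set} (R? : Decidable R) {x w} → w ≢ x → Ignores R w →
            count (λ f → R? f ×-dec (lookup f w Fin.≟ lookup f x)) * m ≤ count R?
collision {m} {n} {R} R? {x} {w} w≢x ign = begin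
  count (λ f → R? f ×-dec (lookup f w Fin.≟ lookup f x)) * m
    ≡⟨ ∑-resample m n w _ ⟩
  ∑ (allVecs m n) (λ f → ∑ (allFin m) λ a → 𝟙 (R? (f [ w ]≔ a) ×-dec (lookup (f [ w ]≔ a) w Fin.≟ lookup (f [ w ]≔ a) x)))
    ≤⟨ ∑-mono (allVecs m n) (λ {f} _ → bound f) ⟩
  count R? ∎
  where
  open ≤-Reasoning
  bound : ∀ f → ∑ (allFin m) (λ a → 𝟙 (R? (f [ w ]≔ a) ×-dec (lookup (f [ w ]≔ a) w Fin.≟ lookup (f [ w ]≔ a) x))) ≤ 𝟙 (R? f)
  bound f with R? f
  ... | yes _ = ≤-trans
    (∑-mono (allFin m) λ {a} _ → 𝟙-mono (R? (f [ w ]≔ a) ×-dec _) (a Fin.≟ lookup f x) λ (_ , eq) →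
      trans (sym (lookup∘update w f a)) (trans eq (lookup∘update′ (w≢x ∘ sym) f a)))
    (∑-𝟙-≡ (allFin⁺ m) (lookup f x))
  ... | no ¬r = ≤-reflexive (trans
    (∑-cong (allFin m) λ a → n≤0⇒n≡0 (𝟙-mono (R? (f [ w ]≔ a) ×-dec _) (no ¬r) (ign f a ∘ proj₁)))
    (trans (∑-const (allFin m) 0) (*-zeroʳ (length (allFin m)))))

-- Peel off the entries of `W` one by one. The event that `R` holds and the remaining entries agree
-- with `x` still ignores `w`, because `w` is neither `x` nor among them, so `collision` gains one
-- factor `m` per entry.
collisions : ∀ {R : Vec (Fin m) n → Set} (R? : Decidable R) {x} W → x ∉ W → Unique W →
             (∀ {w} → w ∈ W → Ignores R w) →
             count (λ f → R? f ×-dec All.all? (λ w → lookup f w Fin.≟ lookup f x) W) * m ^ length W ≤ count R?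
collisions R? [] x∉W uniq ign =
  ≤-trans (≤-reflexive (*-identityʳ _)) (count-mono (λ f → R? f ×-dec yes []) R? λ _ → proj₁)
collisions {m} {n} {R} R? {x} (w ∷ W) x∉W (w∉W ∷ uniq) ign = begin
  count (λ f → R? f ×-dec All.all? (mono? f) (w ∷ W)) * (m * m ^ length W)
    ≡⟨ sym (*-assoc (count (λ f → R? f ×-dec All.all? (mono? f) (w ∷ W))) m _) ⟩
  count (λ f → R? f ×-dec All.all? (mono? f) (w ∷ W)) * m * m ^ length W
    ≤⟨ *-monoˡ-≤ (m ^ length W) (*-monoˡ-≤ m (count-mono (λ f → R? f ×-dec All.all? (mono? f) (w ∷ W)) (λ f → R′? f ×-dec mono? f w) λ { _ (r , p ∷ ps) → (r , ps) , p })) ⟩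
  count (λ f → R′? f ×-dec mono? f w) * m * m ^ length W
    ≤⟨ *-monoˡ-≤ (m ^ length W) (collision R′? w≢x ign′) ⟩
  count R′? * m ^ length W
    ≤⟨ collisions R? W (x∉W ∘ there) uniq (ign ∘ there) ⟩
  count R? ∎
  where
  open ≤-Reasoning
  mono? : ∀ f w → Dec (lookup f w ≡ lookup f x)
  mono? f w = lookup f w Fin.≟ lookup f x
  R′ : Vec (Fin m) n → Set
  R′ f = R f × All (λ w → lookup f w ≡ lookup f x) W
  R′? : Decidable R′
  R′? f = R? f ×-dec All.all? (mono? f) W
  w≢x : w ≢ x
  w≢x refl = x∉W (here refl)
  ign′ : Ignores R′ w
  ign′ f a (r , ps) = ign (here refl) f a r , All.tabulate λ {y} y∈W →
    trans (sym (lookup∘update′ (λ { refl → All.lookup w∉W y∈W refl }) f a))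
    (trans (All.lookup ps y∈W) (lookup∘update′ (w≢x ∘ sym) f a))

∑-mono-< : ∀ {xs : List A} {g h : A → ℕ} {y} → (∀ x → g x ≤ h x) → y ∈ xs → g y < h y → ∑ xs g < ∑ xs h
∑-mono-< {xs = _ ∷ xs} g≤h (here refl) lt = +-mono-<-≤ lt (∑-mono xs λ {x} _ → g≤h x)
∑-mono-< g≤h (there y∈xs) lt = +-mono-≤-< (g≤h _) (∑-mono-< g≤h y∈xs lt)

𝟙-≤-+ : (P? : Dec P) (Q? : Dec Q) {r : ℕ} → (P → ¬ Q → 1 ≤ r) → 𝟙 P? ≤ 𝟙 Q? + r
𝟙-≤-+ (no  _) Q?      _    = z≤n
𝟙-≤-+ (yes p) (yes _) _    = s≤s z≤n
𝟙-≤-+ (yes p) (no ¬q) 1≤r  = 1≤r p ¬q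

-- Colouring hypergraphs without monochromatic edges

Mono : Vec (Fin m) n → List (Fin n) → Set
Mono f e = All (λ x → All (λ y → lookup f x ≡ lookup f y) e) e

mono? : ∀ (f : Vec (Fin m) n) e → Dec (Mono f e)
mono? f e = All.all? (λ x → All.all? (λ y → lookup f x Fin.≟ lookup f y) e) e

-- `E v` serves as the list of edges through `v`. An edge has `suc k` vertices and is monochromatic
-- with probability `m ^ k` to the power -1; `d-small` says that `d` such events, each weighted by
-- `2 ^ suc k`, have total weight at most 1/2.
module HypergraphColouring
  {n m k d : ℕ} .{{_ : NonZero m}}
  (E : Fin n → List (List (Fin n)))
  (E-unique : ∀ {v e} → e ∈ E v → Unique e)
  (E-length : ∀ {v e} → e ∈ E v → length e ≡ suc k)
  (E-closed : ∀ {v w e} → e ∈ E v → w ∈ e → e ∈ E w)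
  (E-degree : ∀ v → length (E v) ≤ d)
  (d-small  : 2 * (d * 2 ^ suc k) ≤ m ^ k)
  where

  open DecMembership (Fin._≟_ {n}) using (_∈?_)

  -- Only edges lying wholly in `S` are tested, which makes goodness independent of the colours
  -- outside `S`.
  Good : List (Fin n) → Vec (Fin m) n → Set
  Good S f = ∀ v → All (λ e → ¬ (All (_∈ S) e × Mono f e)) (E v)

  good? : ∀ S f → Dec (Good S f)
  good? S f = Fin.all? λ v → All.all? (λ e → ¬? (All.all? (_∈? S) e ×-dec mono? f e)) (E v)

  good-anti : ∀ {S S′} → S ⊆ S′ → ∀ f → Good S′ f → Good S f
  good-anti S⊆S′ f good v = All.map (λ ok (e⊆S , mono) → ok (All.map S⊆S′ e⊆S , mono)) (good v)

  good-ignores : ∀ {S w} → w ∉ S → Ignores (Good S) w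
  good-ignores {S} {w} w∉S f a good v = All.map (λ ok (e⊆S , mono) → ok (e⊆S ,
    All.tabulate λ x∈e → All.tabulate λ y∈e →
      trans (same (All.lookup e⊆S x∈e)) (trans (All.lookup (All.lookup mono x∈e) y∈e)
        (sym (same (All.lookup e⊆S y∈e)))))) (good v)
    where
    same : ∀ {x} → x ∈ S → lookup (f [ w ]≔ a) x ≡ lookup f x
    same x∈S = lookup∘update′ (λ { refl → w∉S x∈S }) f a

  #good : List (Fin n) → ℕ
  #good S = count (good? S)

  #good-anti : ∀ {S S′} → S ⊆ S′ → #good S′ ≤ #good S
  #good-anti {S} {S′} S⊆S′ = count-mono (good? S′) (good? S) (good-anti S⊆S′)

  -- Lists may repeat vertices, so distinct members are counted. This is the induction measure of
  -- `#good-step`.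
  size : List (Fin n) → ℕ
  size S = ∑ (allFin n) λ x → 𝟙 (x ∈? S)

  size-< : ∀ {S S′ x} → S ⊆ S′ → x ∈ S′ → x ∉ S → size S < size S′
  size-< {S} {S′} {x} S⊆S′ x∈S′ x∉S =
    ∑-mono-< (λ y → 𝟙-mono (y ∈? S) (y ∈? S′) S⊆S′) (∈-allFin x) lt
    where
    lt : 𝟙 (x ∈? S) < 𝟙 (x ∈? S′)
    lt with x ∈? S
    ... | yes x∈S = contradiction x∈S x∉S
    ... | no  _   = ≤-reflexive (sym (𝟙-yes (x ∈? S′) x∈S′))

  -- An edge inside `v ∷ S` that avoids `v` already lies in `S` and is not monochromatic. So a new
  -- violation contains `v`, and `E-closed` moves it into `E v`.
  violation : ∀ S v f → Good S f → ¬ Good (v ∷ S) f →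
              Any (λ e → Good S f × All (_∈ v ∷ S) e × Mono f e) (E v)
  violation S v f good ¬good =
    decidable-stable (Any.any? (λ e → good? S f ×-dec All.all? (_∈? (v ∷ S)) e ×-dec mono? f e) (E v))
    λ none → ¬good λ w → All.tabulate λ {e} e∈E (e⊆ , mono) → case e e∈E e⊆ mono none (v ∈? e)
    where
    case : ∀ {w} e → e ∈ E w → All (_∈ v ∷ S) e → Mono f e →
           ¬ Any (λ e → Good S f × All (_∈ v ∷ S) e × Mono f e) (E v) → ¬ Dec (v ∈ e)
    case e e∈E e⊆ mono none (yes v∈e) =
      none (Any.map (λ { refl → good , e⊆ , mono }) (E-closed e∈E v∈e))
    case {w} e e∈E e⊆ mono none (no v∉e) = All.lookup (good w) e∈E (All.tabulate inS , mono)
      where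
      inS : ∀ {x} → x ∈ e → x ∈ S
      inS x∈e with All.lookup e⊆ x∈e
      ... | here refl = contradiction x∈e v∉e
      ... | there x∈S = x∈S

  _∖_ : List (Fin n) → List (Fin n) → List (Fin n)
  S ∖ e = filter (λ x → ¬? (x ∈? e)) S

  bad? : ∀ S v e f → Dec (Good S f × All (_∈ v ∷ S) e × Mono f e)
  bad? S v e f = good? S f ×-dec All.all? (_∈? (v ∷ S)) e ×-dec mono? f e

  -- Union bound over the edges supplied by `violation`.
  #good-split : ∀ S v → #good S ≤ #good (v ∷ S) + ∑ (E v) (λ e → count (bad? S v e))
  #good-split S v = begin
    #good S
      ≤⟨ ∑-mono (allVecs m n) (λ {f} _ → split f) ⟩
    ∑ (allVecs m n) (λ f → 𝟙 (good? (v ∷ S) f) + ∑ (E v) (λ e → 𝟙 (bad? S v e f)))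
      ≡⟨ ∑-distrib-+ (allVecs m n) _ _ ⟩
    #good (v ∷ S) + ∑ (allVecs m n) (λ f → ∑ (E v) (λ e → 𝟙 (bad? S v e f)))
      ≡⟨ cong (#good (v ∷ S) +_) (∑-comm (allVecs m n) (E v) _) ⟩
    #good (v ∷ S) + ∑ (E v) (λ e → count (bad? S v e)) ∎
    where
    open ≤-Reasoning
    split : ∀ f → 𝟙 (good? S f) ≤ 𝟙 (good? (v ∷ S) f) + ∑ (E v) (λ e → 𝟙 (bad? S v e f))
    split f = 𝟙-≤-+ (good? S f) (good? (v ∷ S) f) λ good ¬good →
      let e , e∈E , bad = find (violation S v f good ¬good) in
      ≤-trans (≤-reflexive (sym (𝟙-yes (bad? S v e f) bad))) (∈⇒≤∑ (λ e → 𝟙 (bad? S v e f)) e∈E)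

  -- After `S` is shrunk by the vertices of `e`, goodness ignores all of `e`. The `k` vertices of
  -- `e` after its head must then each agree with the head, and `collisions` applies.
  #bad-bound : ∀ S {v e} → e ∈ E v → count (bad? S v e) * m ^ k ≤ #good (S ∖ e)
  #bad-bound S {v} {e} e∈E = bound e (E-unique e∈E) (E-length e∈E)
    where
    bound : ∀ e → Unique e → length e ≡ suc k → count (bad? S v e) * m ^ k ≤ #good (S ∖ e)
    bound e@(x ∷ W) (x∉W ∷ uniq) refl = ≤-trans
      (*-monoˡ-≤ (m ^ length W) (count-mono (bad? S v e) (λ f → good? (S ∖ e) f ×-dec All.all? (λ w → lookup f w Fin.≟ lookup f x) W)
      λ { f (good , _ , mono) → good-anti (proj₁ ∘ ∈-filter⁻ (λ x → ¬? (x ∈? e)) {xs = S}) f good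
                            , All.map (λ { (p ∷ _) → p }) (All.tail mono) }))
      (collisions (good? (S ∖ e)) W (λ x∈W → All.lookup x∉W x∈W refl) uniq
      λ w∈W → good-ignores λ w∈S → proj₂ (∈-filter⁻ (λ x → ¬? (x ∈? e)) {xs = S} w∈S) (there w∈W))

  -- Rosenfeld's counting form of the local lemma: a good colouring of S stays good
  -- on S ∪ {v} with conditional probability at least 1/2.
  -- The bad event of an edge e is independent of goodness on S ∖ e, and putting
  -- the vertices of e back costs a factor 2 each by induction on the size of S.
  #good-step : ∀ s S v → size S < s → #good S ≤ 2 * #good (v ∷ S)
  #good-step (suc s) S v S<s = *-cancelʳ-≤ _ _ (m ^ k) {{m^n≢0 m k}} (+-cancelʳ-≤ (#good S * m ^ k) _ _ double)
    where
    open ≤-Reasoning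
    regrow : ∀ W {T} → W ⊆ S → T ⊆ S → #good T ≤ 2 ^ length W * #good (W ++ T)
    regrow []      W⊆S T⊆S = ≤-reflexive (sym (+-identityʳ _))
    regrow (w ∷ W) {T} W⊆S T⊆S = begin
      #good T                                  ≤⟨ regrow W (W⊆S ∘ there) T⊆S ⟩
      2 ^ length W * #good (W ++ T)            ≤⟨ *-monoʳ-≤ (2 ^ length W) (one (w ∈? (W ++ T))) ⟩
      2 ^ length W * (2 * #good (w ∷ W ++ T))  ≡⟨ sym (*-assoc (2 ^ length W) 2 _) ⟩
      2 ^ length W * 2 * #good (w ∷ W ++ T)    ≡⟨ cong (_* #good (w ∷ W ++ T)) (*-comm (2 ^ length W) 2) ⟩
      2 ^ suc (length W) * #good (w ∷ W ++ T)  ∎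
      where
      sub : W ++ T ⊆ S
      sub x∈ with ∈-++⁻ W x∈
      ... | inj₁ x∈W = W⊆S (there x∈W)
      ... | inj₂ x∈T = T⊆S x∈T
      one : Dec (w ∈ W ++ T) → #good (W ++ T) ≤ 2 * #good (w ∷ W ++ T)
      one (yes w∈) = ≤-trans (#good-anti λ { (here refl) → w∈ ; (there x∈) → x∈ }) (m≤m+n _ _)
      -- Here `w` is in `S` but not in `W ++ T`, so the size is strictly below that of `S` and the
      -- induction hypothesis applies.
      one (no w∉)  = #good-step s (W ++ T) w
        (<-≤-trans (size-< sub (W⊆S (here refl)) w∉) (≤-pred S<s))

    removed : ∀ {e} → e ∈ E v → #good (S ∖ e) ≤ 2 ^ suc k * #good S
    removed {e} e∈E = begin
      #good (S ∖ e)                         ≤⟨ regrow W (proj₂ ∘ ∈-filter⁻ (_∈? S) {xs = e}) (proj₁ ∘ ∈-filter⁻ (λ x → ¬? (x ∈? e)) {xs = S}) ⟩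
      2 ^ length W * #good (W ++ (S ∖ e))   ≤⟨ *-mono-≤ (^-monoʳ-≤ 2 (≤-trans (length-filter (_∈? S) e) (≤-reflexive (E-length e∈E)))) (#good-anti cover) ⟩
      2 ^ suc k * #good S                   ∎
      where
      W = filter (_∈? S) e
      cover : S ⊆ W ++ (S ∖ e)
      cover {x} x∈S with x ∈? e
      ... | yes x∈e = ∈-++⁺ˡ (∈-filter⁺ (_∈? S) x∈e x∈S)
      ... | no  x∉e = ∈-++⁺ʳ W (∈-filter⁺ (λ x → ¬? (x ∈? e)) x∈S x∉e)

    bad-total : ∑ (E v) (λ e → count (bad? S v e)) * m ^ k ≤ d * (2 ^ suc k * #good S)
    bad-total = begin
      ∑ (E v) (λ e → count (bad? S v e)) * m ^ k    ≡⟨ ∑-distribʳ-* (E v) _ (m ^ k) ⟩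
      ∑ (E v) (λ e → count (bad? S v e) * m ^ k)    ≤⟨ ∑-mono (E v) (λ e∈E → ≤-trans (#bad-bound S e∈E) (removed e∈E)) ⟩
      ∑ (E v) (λ _ → 2 ^ suc k * #good S)           ≡⟨ ∑-const (E v) _ ⟩
      length (E v) * (2 ^ suc k * #good S)          ≤⟨ *-monoˡ-≤ _ (E-degree v) ⟩
      d * (2 ^ suc k * #good S)                     ∎

    -- The bad colourings make up at most half of `#good S`; the extra summand on both sides
    -- expresses this without subtraction.
    double : #good S * m ^ k + #good S * m ^ k ≤ 2 * #good (v ∷ S) * m ^ k + #good S * m ^ k
    double = begin
      #good S * m ^ k + #good S * m ^ k
        ≡⟨ rearrange₁ (#good S) (m ^ k) ⟩
      2 * (#good S * m ^ k)
        ≤⟨ *-monoʳ-≤ 2 (*-monoˡ-≤ (m ^ k) (#good-split S v)) ⟩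
      2 * ((#good (v ∷ S) + bad) * m ^ k)
        ≡⟨ rearrange₂ (#good (v ∷ S)) bad (m ^ k) ⟩
      2 * #good (v ∷ S) * m ^ k + 2 * (bad * m ^ k)
        ≤⟨ +-monoʳ-≤ (2 * #good (v ∷ S) * m ^ k) (*-monoʳ-≤ 2 bad-total) ⟩
      2 * #good (v ∷ S) * m ^ k + 2 * (d * (2 ^ suc k * #good S))
        ≡⟨ cong (2 * #good (v ∷ S) * m ^ k +_) (rearrange₃ d (2 ^ suc k) (#good S)) ⟩
      2 * #good (v ∷ S) * m ^ k + #good S * (2 * (d * 2 ^ suc k))
        ≤⟨ +-monoʳ-≤ (2 * #good (v ∷ S) * m ^ k) (*-monoʳ-≤ (#good S) d-small) ⟩
      2 * #good (v ∷ S) * m ^ k + #good S * m ^ k ∎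
      where
      bad = ∑ (E v) (λ e → count (bad? S v e))
      rearrange₁ : ∀ a b → a * b + a * b ≡ 2 * (a * b)
      rearrange₁ = solve-∀
      rearrange₂ : ∀ a b c → 2 * ((a + b) * c) ≡ 2 * a * c + 2 * (b * c)
      rearrange₂ = solve-∀
      rearrange₃ : ∀ a b c → 2 * (a * (b * c)) ≡ c * (2 * (a * b))
      rearrange₃ = solve-∀

  -- On the empty set all `m ^ n` colourings are good, since no edge is empty. Each further vertex
  -- at worst halves the count.
  #good>0 : ∀ S → 0 < #good S
  #good>0 [] = <-≤-trans (m^n>0 m n) (≤-reflexive (sym (count-full (good? []) trivial)))
    where
    trivial : ∀ f → Good [] f
    trivial f v = All.tabulate λ {e} e∈E (e⊆[] , _) → nonempty e (E-length e∈E) e⊆[]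
      where
      nonempty : ∀ e → length e ≡ suc k → ¬ All (_∈ []) e
      nonempty (x ∷ e) _ (() ∷ _)
  #good>0 (v ∷ S) = n≢0⇒n>0 λ eq → <⇒≱ (#good>0 S)
    (≤-trans (#good-step (suc (size S)) S v ≤-refl) (≤-reflexive (cong (2 *_) eq)))

  colouring : ∃[ f ] (∀ {v e} → e ∈ E v → ¬ Mono f e)
  colouring with f , good>0 ← ∑>0⇒∃ (allVecs m n) _ (#good>0 (allFin n)) =
    f , λ {v} e∈E mono → All.lookup (𝟙>0 (good? (allFin n) f) good>0 v) e∈E (All.tabulate (λ {x} _ → ∈-allFin x) , mono)

-- Counting combinations

^-distribʳ-* : ∀ a b k → (a * b) ^ k ≡ a ^ k * b ^ k
^-distribʳ-* a b zero    = refl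
^-distribʳ-* a b (suc k) = trans (cong (a * b *_) (^-distribʳ-* a b k)) ([m*n]*[o*p]≡[m*o]*[n*p] a b _ _)

-- The first two terms of the binomial expansion. Multiplying the bound for `k` by `suc a`
-- overshoots the next one by exactly `suc k * a ^ k`.
bernoulli : ∀ a k → suc k * a ^ k + a ^ suc k ≤ suc a ^ suc k
bernoulli a zero    = ≤-reflexive (base a)
  where
  base : ∀ a → 1 + a * 1 ≡ (1 + a) * 1
  base = solve-∀
bernoulli a (suc k) = begin
  suc (suc k) * (a * a ^ k) + a * (a * a ^ k)                    ≤⟨ m≤m+n _ (suc k * a ^ k) ⟩
  suc (suc k) * (a * a ^ k) + a * (a * a ^ k) + suc k * a ^ k    ≡⟨ expand a k (a ^ k) ⟩
  suc a * (suc k * a ^ k + a * a ^ k)                            ≤⟨ *-monoʳ-≤ (suc a) (bernoulli a k) ⟩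
  suc a ^ suc (suc k)                                            ∎
  where
  open ≤-Reasoning
  expand : ∀ a k p → (2 + k) * (a * p) + a * (a * p) + (1 + k) * p ≡ (1 + a) * ((1 + k) * p + a * p)
  expand = solve-∀

m^j*m!≤[j+m]! : ∀ m j → m ^ j * m ! ≤ (j + m) !
m^j*m!≤[j+m]! m zero    = ≤-reflexive (+-identityʳ (m !))
m^j*m!≤[j+m]! m (suc j) = begin
  m * m ^ j * m !            ≡⟨ *-assoc m (m ^ j) (m !) ⟩
  m * (m ^ j * m !)          ≤⟨ *-mono-≤ (≤-trans (m≤n+m m j) (n≤1+n (j + m))) (m^j*m!≤[j+m]! m j) ⟩
  suc (j + m) * (j + m) !    ∎
  where open ≤-Reasoning

-- The central binomial coefficient is at most `4 ^ k`: in each step the two new factors are both at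
-- most twice `suc k`.
[2k]!≤4^k*k!² : ∀ k → (k + k) ! ≤ 4 ^ k * (k ! * k !)
[2k]!≤4^k*k!² zero    = ≤-refl
[2k]!≤4^k*k!² (suc k) rewrite +-suc k k = begin
  (2 + (k + k)) * ((1 + (k + k)) * (k + k) !)              ≤⟨ *-monoʳ-≤ (2 + (k + k)) (*-monoˡ-≤ ((k + k) !) (n≤1+n (1 + (k + k)))) ⟩
  (2 + (k + k)) * ((2 + (k + k)) * (k + k) !)              ≤⟨ *-monoʳ-≤ (2 + (k + k)) (*-monoʳ-≤ (2 + (k + k)) ([2k]!≤4^k*k!² k)) ⟩
  (2 + (k + k)) * ((2 + (k + k)) * (4 ^ k * (k ! * k !)))  ≡⟨ rearrange k (4 ^ k) (k !) ⟩
  4 ^ suc k * (suc k ! * suc k !)                          ∎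
  where
  open ≤-Reasoning
  rearrange : ∀ k p q → (2 + (k + k)) * ((2 + (k + k)) * (p * (q * q))) ≡ 4 * p * ((1 + k) * q * ((1 + k) * q))
  rearrange = solve-∀

-- A crude Stirling bound, obtained by comparing `k ^ k * k !` with `(k + k) !`.
k^k≤4^k*k! : ∀ k → k ^ k ≤ 4 ^ k * k !
k^k≤4^k*k! k = *-cancelʳ-≤ _ _ (k !) {{k !≢0}} (begin
  k ^ k * k !             ≤⟨ m^j*m!≤[j+m]! k k ⟩
  (k + k) !               ≤⟨ [2k]!≤4^k*k!² k ⟩
  4 ^ k * (k ! * k !)     ≡⟨ sym (*-assoc (4 ^ k) (k !) (k !)) ⟩
  4 ^ k * k ! * k !       ∎)
  where open ≤-Reasoning

combinations : ℕ → List A → List (List A)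
combinations zero    xs       = [] ∷ []
combinations (suc k) []       = []
combinations (suc k) (x ∷ xs) = map (x ∷_) (combinations k xs) ++ combinations (suc k) xs

-- Pascal's recursion, matched term by term with `bernoulli`.
length-combinations : ∀ k (xs : List A) → length (combinations k xs) * k ! ≤ length xs ^ k
length-combinations zero    xs       = ≤-refl
length-combinations (suc k) []       = z≤n
length-combinations (suc k) (x ∷ xs) = begin
  length (map (x ∷_) (combinations k xs) ++ combinations (suc k) xs) * suc k !
    ≡⟨ cong (_* suc k !) (trans (length-++ (map (x ∷_) (combinations k xs))) (cong (_+ q) (length-map (x ∷_) (combinations k xs)))) ⟩
  (p + q) * suc k !
    ≡⟨ rearrange p q k (k !) ⟩
  suc k * (p * k !) + q * suc k !
    ≤⟨ +-mono-≤ (*-monoʳ-≤ (suc k) (length-combinations k xs)) (length-combinations (suc k) xs) ⟩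
  suc k * length xs ^ k + length xs ^ suc k
    ≤⟨ bernoulli (length xs) k ⟩
  suc (length xs) ^ suc k ∎
  where
  open ≤-Reasoning
  p = length (combinations k xs)
  q = length (combinations (suc k) xs)
  rearrange : ∀ p q k f → (p + q) * ((1 + k) * f) ≡ (1 + k) * (p * f) + q * ((1 + k) * f)
  rearrange = solve-∀

∈-combinations⁺ : ∀ {ys xs : List A} → ys ⊑ xs → ys ∈ combinations (length ys) xs
∈-combinations⁺ {ys = []}     _           = here refl
∈-combinations⁺ {ys = y ∷ ys} (x ∷ʳ τ)    = ∈-++⁺ʳ (map (x ∷_) (combinations (length ys) _)) (∈-combinations⁺ τ)
∈-combinations⁺ {ys = y ∷ ys} (refl ∷ τ)  = ∈-++⁺ˡ (∈-map⁺ (y ∷_) (∈-combinations⁺ τ))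

∈-combinations⁻ : ∀ k (xs : List A) {ys} → ys ∈ combinations k xs → ys ⊑ xs × length ys ≡ k
∈-combinations⁻ zero    xs       (here refl) = Sublist.minimum xs , refl
∈-combinations⁻ (suc k) (x ∷ xs) ys∈ with ∈-++⁻ (map (x ∷_) (combinations k xs)) ys∈
... | inj₂ ys∈r with τ , eq ← ∈-combinations⁻ (suc k) xs ys∈r = x ∷ʳ τ , eq
... | inj₁ ys∈l with zs , zs∈ , refl ← ∈-map⁻ (x ∷_) ys∈l with τ , eq ← ∈-combinations⁻ k xs zs∈ = refl ∷ τ , cong suc eq

Unique-resp-⊑ : ∀ {ys xs : List A} → ys ⊑ xs → Unique xs → Unique ys
Unique-resp-⊑ []         []            = []
Unique-resp-⊑ (_ ∷ʳ τ)   (_ ∷ uniq)    = Unique-resp-⊑ τ uniq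
Unique-resp-⊑ (refl ∷ τ) (x∉ ∷ uniq)   = All-resp-⊆ τ x∉ ∷ Unique-resp-⊑ τ uniq

-- Splitting neighbourhoods evenly

-- With K = `suc k`, `B` is at most (4`D`/K)^K. Times K^K, the left side is then at most
-- 2`D`(8`D`)^K, which is 16`D`²(8`D`)^k. The hypothesis on `2 ^ k` absorbs 16`D`² and turns 8 into
-- 16, and (16`D`)^k is at most (`m`K)^k.
local-lemma-condition : ∀ {m k D B} → B * suc k ! ≤ D ^ suc k → 16 * D ≤ m * suc k → 16 * (D * D) ≤ 2 ^ k →
                        2 * (D * B * 2 ^ suc k) ≤ m ^ k
local-lemma-condition {m} {k} {D} {B} B-small m-large k-large = *-cancelʳ-≤ _ _ (K ^ K) {{m^n≢0 K K}} (begin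
  2 * (D * B * 2 ^ K) * K ^ K                ≡⟨ rearrange₁ D B (2 ^ K) (K ^ K) ⟩
  2 * D * 2 ^ K * (B * K ^ K)                ≤⟨ *-monoʳ-≤ (2 * D * 2 ^ K) B*K^K ⟩
  2 * D * 2 ^ K * (4 ^ K * D ^ K)            ≡⟨ rearrange₂ D (2 ^ k) (4 ^ k) (D ^ k) ⟩
  16 * (D * D) * (2 ^ k * 4 ^ k * D ^ k)     ≤⟨ *-monoˡ-≤ _ k-large ⟩
  2 ^ k * (2 ^ k * 4 ^ k * D ^ k)            ≡⟨ sym powers ⟩
  (16 * D) ^ k                               ≤⟨ ^-monoˡ-≤ k m-large ⟩
  (m * K) ^ k                                ≡⟨ ^-distribʳ-* m K k ⟩
  m ^ k * K ^ k                              ≤⟨ *-monoʳ-≤ (m ^ k) (m≤n*m (K ^ k) K) ⟩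
  m ^ k * K ^ K                              ∎)
  where
  open ≤-Reasoning
  K = suc k
  B*K^K : B * K ^ K ≤ 4 ^ K * D ^ K
  B*K^K = begin
    B * K ^ K            ≤⟨ *-monoʳ-≤ B (k^k≤4^k*k! K) ⟩
    B * (4 ^ K * K !)    ≡⟨ *-comm B _ ⟩
    4 ^ K * K ! * B      ≡⟨ *-assoc (4 ^ K) (K !) B ⟩
    4 ^ K * (K ! * B)    ≡⟨ cong (4 ^ K *_) (*-comm (K !) B) ⟩
    4 ^ K * (B * K !)    ≤⟨ *-monoʳ-≤ (4 ^ K) B-small ⟩
    4 ^ K * D ^ K        ∎
  rearrange₁ : ∀ d b p q → 2 * (d * b * p) * q ≡ 2 * d * p * (b * q)
  rearrange₁ = solve-∀
  rearrange₂ : ∀ d p q r → 2 * d * (2 * p) * (4 * q * (d * r)) ≡ 16 * (d * d) * (p * q * r)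
  rearrange₂ = solve-∀
  powers : (16 * D) ^ k ≡ 2 ^ k * (2 ^ k * 4 ^ k * D ^ k)
  powers = begin-equality
    (16 * D) ^ k                        ≡⟨ ^-distribʳ-* 16 D k ⟩
    16 ^ k * D ^ k                      ≡⟨ cong (_* D ^ k) (trans (^-distribʳ-* 2 8 k) (cong (2 ^ k *_) (^-distribʳ-* 2 4 k))) ⟩
    2 ^ k * (2 ^ k * 4 ^ k) * D ^ k     ≡⟨ *-assoc (2 ^ k) _ _ ⟩
    2 ^ k * (2 ^ k * 4 ^ k * D ^ k)     ∎

module _
  {n D : ℕ} (N : Fin n → List (Fin n))
  (N-unique : ∀ u → Unique (N u))
  (N-sym    : ∀ {u w} → w ∈ N u → u ∈ N w)
  (N-length : ∀ u → length (N u) ≤ D)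
  where

  open DecMembership (Fin._≟_ {n}) using (_∈?_)

  -- Take as hyperedges all sets of `suc k` vertices inside some `N u`. A colour used more than `k`
  -- times on `N u` would contain a monochromatic hyperedge.
  frugal-colouring : ∀ {m k} .{{_ : NonZero m}} → 16 * D ≤ m * suc k → 16 * (D * D) ≤ 2 ^ k →
    ∃[ f ] (∀ u (a : Fin m) → length (filter (λ w → lookup f w Fin.≟ a) (N u)) ≤ k)
  frugal-colouring {m} {k} m-large k-large = let f , no-mono = result in f , frugal f no-mono
    where
    K = suc k
    instance _ = K !≢0
    -- Rounding down is harmless because the number of combinations is an integer.
    b = D ^ K / K !

    -- By symmetry, a hyperedge inside `N u` that contains `v` has `u` in `N v`, so ranging over
    -- `N v` misses none of them.
    edges : Fin n → List (List (Fin n))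
    edges v = concatMap (λ u → combinations K (N u)) (N v)

    E : Fin n → List (List (Fin n))
    E v = filter (v ∈?_) (edges v)

    E⁻ : ∀ {v e} → e ∈ E v → ∃[ u ] (e ⊑ N u × length e ≡ K)
    E⁻ {v} e∈E with u , _ , e∈ ← find (∈-concatMap⁻ (λ u → combinations K (N u)) {xs = N v} (proj₁ (∈-filter⁻ (v ∈?_) {xs = edges v} e∈E)))
      = u , ∈-combinations⁻ K (N u) e∈

    E⁺ : ∀ {v e u} → e ⊑ N u → length e ≡ K → v ∈ e → e ∈ E v
    E⁺ {v} {e} {u} τ len v∈e = ∈-filter⁺ (v ∈?_)
      (∈-concatMap⁺ (λ u → combinations K (N u)) (Any.map (λ { refl → subst (λ k → e ∈ combinations k (N u)) len (∈-combinations⁺ τ) }) (N-sym (Any-resp-⊆ τ v∈e)))) v∈e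

    combinations-≤b : ∀ u → length (combinations K (N u)) ≤ b
    combinations-≤b u = ≤-trans (≤-reflexive (sym (m*n/n≡m (length (combinations K (N u))) (K !))))
      (/-monoˡ-≤ (K !) (≤-trans (length-combinations K (N u)) (^-monoˡ-≤ K (N-length u))))

    frugal : (f : Vec (Fin m) n) → (∀ {v e} → e ∈ E v → ¬ Mono f e) →
             ∀ u a → length (filter (λ w → lookup f w Fin.≟ a) (N u)) ≤ k
    frugal f no-mono u a = ≮⇒≥ λ k<len → crowded e refl (trans (length-take K F) (m≤n⇒m⊓n≡m k<len))
      where
      F = filter (λ w → lookup f w Fin.≟ a) (N u)
      e = take K F
      τ : e ⊑ N u
      τ = Sublist.⊆-trans (take-⊆ K F) (filter-⊆ (λ w → lookup f w Fin.≟ a) (N u))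
      same : All (λ w → lookup f w ≡ a) e
      same = All-resp-⊆ (take-⊆ K F) (all-filter (λ w → lookup f w Fin.≟ a) (N u))
      mono : Mono f e
      mono = All.map (λ p → All.map (λ q → trans p (sym q)) same) same
      -- Hyperedges are listed by vertex, so a head of `e` has to be exposed before `no-mono` can be
      -- used.
      crowded : ∀ e′ → e′ ≡ e → ¬ length e ≡ K
      crowded []      eq len with () ← trans (cong length eq) len
      crowded (x ∷ _) eq len = no-mono (E⁺ τ len (subst (x ∈_) eq (here refl))) mono

    result : ∃[ f ] (∀ {v e} → e ∈ E v → ¬ Mono f e)
    result = HypergraphColouring.colouring {n} {m} {k} {D * b} E
      (λ e∈E → let u , τ , _ = E⁻ e∈E in Unique-resp-⊑ τ (N-unique u))
      (λ e∈E → proj₂ (proj₂ (E⁻ e∈E)))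
      (λ e∈E w∈e → let u , τ , len = E⁻ e∈E in E⁺ τ len w∈e)
      (λ v → ≤-trans (length-filter (v ∈?_) (edges v)) (length-concatMap-≤ _ (N v) (N-length v) combinations-≤b))
      (local-lemma-condition {m} {k} {D} {b} (m/n*n≤m (D ^ K) (K !)) m-large k-large)

-- Greedy colouring

-- If all `suc d` colours occurred, two of them would share a position among the at most `d` entries
-- of `cs`.
fresh : ∀ {d} (cs : List (Fin (suc d))) → length cs ≤ d → ∃[ c ] c ∉ cs
fresh {d} cs cs≤d = decidable-stable (Fin.any? λ c → ¬? (c ∈? cs)) λ none →
  let all∈ = λ c → decidable-stable (c ∈? cs) λ c∉ → none (c , c∉)
      i , j , i<j , eq = Fin.pigeonhole (s≤s cs≤d) (λ c → Any.index (all∈ c))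
  in Fin.<⇒≢ i<j (trans (lookup-index (all∈ i)) (trans (cong (List.lookup cs) eq) (sym (lookup-index (all∈ j)))))
  where open DecMembership (Fin._≟_ {suc d}) using (_∈?_)

module _
  {n d : ℕ} (conflicts : Fin n → List (Fin n))
  (conflicts-sym    : ∀ {v w} → w ∈ conflicts v → v ∈ conflicts w)
  (conflicts-length : ∀ v → length (conflicts v) ≤ d)
  where

  -- The new colour of `x` avoids the current colours of all its conflicts, processed or not, which
  -- excludes at most `d` colours. A repeated vertex is merely recoloured.
  greedy : ∀ vs → ∃ λ (χ : Fin n → Fin (suc d)) → ∀ {v w} → v ∈ vs → w ∈ vs → w ∈ conflicts v → w ≢ v → χ v ≢ χ w
  greedy []       = (λ _ → zero) , λ ()
  greedy (x ∷ vs) = χ′ , proper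
    where
    χ = proj₁ (greedy vs)
    new = fresh (map χ (conflicts x)) (≤-trans (≤-reflexive (length-map χ (conflicts x))) (conflicts-length x))
    c = proj₁ new
    χ′ : Fin n → Fin (suc d)
    χ′ y with y Fin.≟ x
    ... | yes _ = c
    ... | no  _ = χ y
    old : ∀ {y} → y ∈ x ∷ vs → y ≢ x → y ∈ vs
    old (here eq)  y≢x = contradiction eq y≢x
    old (there y∈) y≢x = y∈
    proper : ∀ {v w} → v ∈ x ∷ vs → w ∈ x ∷ vs → w ∈ conflicts v → w ≢ v → χ′ v ≢ χ′ w
    proper {v} {w} v∈ w∈ wv w≢v eq with v Fin.≟ x | w Fin.≟ x
    ... | yes refl | yes refl = w≢v refl
    ... | yes refl | no  _    = proj₂ new (subst (_∈ map χ (conflicts x)) (sym eq) (∈-map⁺ χ wv))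
    ... | no  _    | yes refl = proj₂ new (subst (_∈ map χ (conflicts x)) eq (∈-map⁺ χ (conflicts-sym wv)))
    ... | no  v≢x  | no  w≢x  = proj₂ (greedy vs) (old v∈ v≢x) (old w∈ w≢x) wv w≢v eq

  proper-colouring : ∃ λ (χ : Fin n → Fin (suc d)) → ∀ v w → w ∈ conflicts v → w ≢ v → χ v ≢ χ w
  proper-colouring with χ , proper ← greedy (allFin n) = χ , λ v w → proper (∈-allFin v) (∈-allFin w)

-- Hash families

-- Entries of S equal to c are allowed, so that short lists can be padded with c.
Clash : ∀ {M N k} → Vec (Fin M) N → Vec (Fin N) (suc k) → Set
Clash g (c ∷ S) = ∃[ i ] (lookup S i ≢ c × lookup g (lookup S i) ≡ lookup g c)

clash? : ∀ {M N k} (g : Vec (Fin M) N) (x : Vec (Fin N) (suc k)) → Dec (Clash g x)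
clash? g (c ∷ S) = Fin.any? λ i → ¬? (lookup S i Fin.≟ c) ×-dec (lookup g (lookup S i) Fin.≟ lookup g c)

module _ {M N k : ℕ} .{{_ : NonZero k}} (M≡2k : M ≡ 2 * k) where

  -- Union bound: each of the `k` entries of `S` that differs from `c` collides with `c` under at
  -- most a 1/(2`k`) share of the maps.
  count-clash : ∀ (x : Vec (Fin N) (suc k)) → 2 * count {M} {N} (λ g → clash? g x) ≤ M ^ N
  count-clash x@(c ∷ S) = *-cancelʳ-≤ _ _ k (begin
    2 * count clash * k                                                  ≡⟨ trans (rearrange (count clash) k) (cong (count clash *_) (sym M≡2k)) ⟩
    count clash * M                                                      ≤⟨ *-monoˡ-≤ M (∑-mono (allVecs M N) λ {g} _ → union g) ⟩
    ∑ (allVecs M N) (λ g → ∑ (allFin k) (λ i → 𝟙 (hit? i g))) * M        ≡⟨ cong (_* M) (∑-comm (allVecs M N) (allFin k) _) ⟩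
    ∑ (allFin k) (λ i → count (hit? i)) * M                              ≡⟨ ∑-distribʳ-* (allFin k) _ M ⟩
    ∑ (allFin k) (λ i → count (hit? i) * M)                              ≤⟨ ∑-mono (allFin k) (λ {i} _ → count-hit i) ⟩
    ∑ (allFin k) (λ _ → M ^ N)                                           ≡⟨ ∑-const (allFin k) _ ⟩
    length (allFin k) * M ^ N                                            ≡⟨ cong (_* M ^ N) (length-tabulate {n = k} id) ⟩
    k * M ^ N                                                            ≡⟨ *-comm k _ ⟩
    M ^ N * k                                                            ∎)
    where
    open ≤-Reasoning
    clash : ∀ g → Dec (Clash g x)
    clash g = clash? g x
    hit? : ∀ i (g : Vec (Fin M) N) → Dec (lookup S i ≢ c × lookup g (lookup S i) ≡ lookup g c)
    hit? i g = ¬? (lookup S i Fin.≟ c) ×-dec (lookup g (lookup S i) Fin.≟ lookup g c)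
    rearrange : ∀ a k → 2 * a * k ≡ a * (2 * k)
    rearrange = solve-∀
    union : ∀ g → 𝟙 (clash g) ≤ ∑ (allFin k) (λ i → 𝟙 (hit? i g))
    union g = 𝟙-≤-+ (clash g) (no id) λ (i , hit) _ →
      ≤-trans (≤-reflexive (sym (𝟙-yes (hit? i g) hit))) (∈⇒≤∑ (λ i → 𝟙 (hit? i g)) (∈-allFin i))
    count-hit : ∀ i → count (hit? i) * M ≤ M ^ N
    count-hit i = cases (lookup S i Fin.≟ c)
      where
      cases : Dec (lookup S i ≡ c) → count (hit? i) * M ≤ M ^ N
      cases (yes eq) = ≤-trans (≤-reflexive (cong (_* M) (count-empty (hit? i) λ g (ne , _) → ne eq))) z≤n
      cases (no ne)  = ≤-trans
        (*-monoˡ-≤ M (count-mono (hit? i) (λ g → yes tt ×-dec (lookup g (lookup S i) Fin.≟ lookup g c)) λ g (_ , eq) → tt , eq))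
        (≤-trans (collision {R = λ _ → ⊤} (λ _ → yes tt) ne λ _ _ _ → tt) (≤-reflexive (count-full {M} {N} (λ _ → yes tt) λ _ → tt)))

  -- Double counting: each vector of `T` clashes under at most half of the maps, so some map clashes
  -- with at most half of `T`.
  halve-clashes : ∀ (T : List (Vec (Fin N) (suc k))) → ∃[ g ] 2 * ∑ T (λ x → 𝟙 (clash? {M} g x)) ≤ length T
  halve-clashes T = ∑-average (allVecs M N) (λ g → 2 * ∑ T (λ x → 𝟙 (clash? g x))) (length T) (begin-strict
    ∑ (allVecs M N) (λ g → 2 * ∑ T (λ x → 𝟙 (clash? g x)))   ≡⟨ ∑-cong (allVecs M N) (λ g → *-comm 2 (∑ T (λ x → 𝟙 (clash? g x)))) ⟩
    ∑ (allVecs M N) (λ g → ∑ T (λ x → 𝟙 (clash? g x)) * 2)   ≡⟨ sym (∑-distribʳ-* (allVecs M N) _ 2) ⟩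
    ∑ (allVecs M N) (λ g → ∑ T (λ x → 𝟙 (clash? g x))) * 2   ≡⟨ cong (_* 2) (∑-comm (allVecs M N) T _) ⟩
    ∑ T (λ x → count (λ g → clash? g x)) * 2                 ≡⟨ ∑-distribʳ-* T _ 2 ⟩
    ∑ T (λ x → count (λ g → clash? g x) * 2)                 ≤⟨ ∑-mono T (λ {x} _ → ≤-trans (≤-reflexive (*-comm (count (λ g → clash? g x)) 2)) (count-clash x)) ⟩
    ∑ T (λ _ → M ^ N)                                        ≡⟨ ∑-const T (M ^ N) ⟩
    length T * M ^ N                                         <⟨ *-monoˡ-< (M ^ N) {{m^n≢0 M N {{subst NonZero (sym M≡2k) (m*n≢0 2 k)}}}} (n<1+n (length T)) ⟩
    suc (length T) * M ^ N                                   ≡⟨ *-comm (suc (length T)) _ ⟩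
    M ^ N * suc (length T)                                   ≡⟨ cong (_* suc (length T)) (sym (length-allVecs M N)) ⟩
    length (allVecs M N) * suc (length T)                    ∎)
    where open ≤-Reasoning

  -- Each chosen map leaves at most half of the remaining vectors clashing, so after `t` rounds
  -- fewer than one remains.
  clash-free-family : ∀ t (T : List (Vec (Fin N) (suc k))) → length T < 2 ^ t →
    ∃[ gs ] (∀ {x} → x ∈ T → ∃[ j ] ¬ Clash {M} (lookup {n = t} gs j) x)
  clash-free-family zero    []      _      = [] , λ ()
  clash-free-family zero    (_ ∷ _) (s≤s ())
  clash-free-family (suc t) T T<2^t = g ∷ gs , found
    where
    halved = halve-clashes T
    g = proj₁ halved
    T′ = filter (clash? g) T
    rest = clash-free-family t T′ (*-cancelˡ-< 2 _ _ (≤-<-trans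
      (≤-trans (≤-reflexive (cong (2 *_) (length-filter≡∑ (clash? g) T))) (proj₂ halved)) T<2^t))
    gs = proj₁ rest
    found : ∀ {x} → x ∈ T → ∃[ j ] ¬ Clash (lookup (g ∷ gs) j) x
    found {x} x∈T = cases (clash? g x)
      where
      cases : Dec (Clash g x) → ∃[ j ] ¬ Clash (lookup (g ∷ gs) j) x
      cases (no ¬clash) = zero , ¬clash
      cases (yes clash) = let j , ok = proj₂ rest (∈-filter⁺ (clash? g) x∈T clash) in suc j , ok

pad : ∀ k → A → List A → Vec A k
pad zero    c S       = []
pad (suc k) c []      = c ∷ pad k c []
pad (suc k) c (s ∷ S) = s ∷ pad k c S

lookup-pad : ∀ {k} (c : A) {S s} → length S ≤ k → s ∈ S → ∃[ i ] lookup (pad k c S) i ≡ s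
lookup-pad c (s≤s S≤k) (here refl) = zero , refl
lookup-pad c (s≤s S≤k) (there s∈S) with i , eq ← lookup-pad c S≤k s∈S = suc i , eq

-- Every pair of `c` and a short `S` becomes, after padding, one of the `N ^ suc k` vectors that the
-- family handles.
hash-family : ∀ {N k t} .{{_ : NonZero k}} → N ^ suc k < 2 ^ t →
  ∃ λ (gs : Vec (Vec (Fin (2 * k)) N) t) → ∀ c S → length S ≤ k →
    ∃[ j ] (∀ {s} → s ∈ S → s ≢ c → lookup (lookup gs j) s ≢ lookup (lookup gs j) c)
hash-family {N} {k} {t} N^K<2^t =
  let gs , ok = clash-free-family {2 * k} {N} {k} refl t (allVecs N (suc k)) (≤-<-trans (≤-reflexive (length-allVecs N (suc k))) N^K<2^t)
  in gs , λ c S S≤k → let j , ¬clash = ok (∈-allVecs (c ∷ pad k c S)) in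
      j , λ s∈S s≢c eq → let i , eq′ = lookup-pad c S≤k s∈S in
        ¬clash (i , subst (λ s → s ≢ c × lookup (lookup gs j) s ≡ lookup (lookup gs j) c) (sym eq′) (s≢c , eq))

-- Interval supergraphs

maximum : List ℕ → ℕ
maximum = foldr _⊔_ 0

∈⇒≤maximum : ∀ {x xs} → x ∈ xs → x ≤ maximum xs
∈⇒≤maximum {xs = y ∷ ys} (here refl) = m≤m⊔n y (maximum ys)
∈⇒≤maximum {xs = y ∷ ys} (there x∈)  = m≤n⇒m≤o⊔n y (∈⇒≤maximum x∈)

maximum-map-< : ∀ (h : A → ℕ) {b} xs → 0 < b → (∀ {x} → x ∈ xs → h x < b) → maximum (map h xs) < b
maximum-map-< h []       0<b h<b = 0<b
maximum-map-< h (x ∷ xs) 0<b h<b = ⊔-lub (h<b (here refl)) (maximum-map-< h xs 0<b (h<b ∘ there))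

decode : ∀ {a b c d} → Fin (a * (b * (c * d))) → Fin a × Fin b × Fin c × Fin d
decode {a} {b} {c} {d} = map₂ (map₂ (remQuot {c} d) ∘ remQuot {b} (c * d)) ∘ remQuot {a} (b * (c * d))

encode : ∀ {a b c d} → Fin a × Fin b × Fin c × Fin d → Fin (a * (b * (c * d)))
encode (i , j , k , l) = combine i (combine j (combine k l))

decode-encode : ∀ {a b c d} x → decode {a} {b} {c} {d} (encode x) ≡ x
decode-encode {a} {b} {c} {d} (i , j , k , l) =
  trans (cong (map₂ (map₂ (remQuot {c} d) ∘ remQuot {b} (c * d))) (Fin.remQuot-combine i _)) (cong (i ,_)
  (trans (cong (map₂ (remQuot {c} d)) (Fin.remQuot-combine j _)) (cong (j ,_) (Fin.remQuot-combine k l))))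

module _ {n} (G : Graph n) where

  adjacent? : ∀ u w → Dec (adj G u w ≡ true)
  adjacent? u w = adj G u w Bool.≟ true

  N[_] : Fin n → List (Fin n)
  N[ u ] = u ∷ filter (adjacent? u) (allFin n)

  N-adjacent : ∀ {u w} → adj G u w ≡ true → w ∈ N[ u ]
  N-adjacent {u} {w} uw = there (∈-filter⁺ (adjacent? u) (∈-allFin w) uw)

  N-unique : ∀ u → Unique N[ u ]
  N-unique u = All.tabulate (λ { w∈ refl → loop (proj₂ (∈-filter⁻ (adjacent? u) {xs = allFin n} w∈)) })
             ∷ filter⁺ (adjacent? u) (allFin⁺ n)
    where
    loop : ¬ adj G u u ≡ true
    loop uu with () ← trans (sym uu) (irrefl G u)

  N-sym : ∀ {u w} → w ∈ N[ u ] → u ∈ N[ w ]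
  N-sym (here refl) = here refl
  N-sym {u} {w} (there w∈) = N-adjacent (trans (Graph.sym G w u) (proj₂ (∈-filter⁻ (adjacent? u) {xs = allFin n} w∈)))

  N-length : ∀ u → length N[ u ] ≤ suc (maxDegree G)
  N-length u = s≤s (begin
    length (filter (adjacent? u) (allFin n))            ≡⟨ length-filter≡∑ (adjacent? u) (allFin n) ⟩
    ∑ (allFin n) (λ w → 𝟙 (adjacent? u w))              ≡⟨ ∑-cong (allFin n) (λ w → 𝟙-true (adj G u w)) ⟩
    degree G u                                          ≤⟨ ∈⇒≤maximum (∈-map⁺ (degree G) (∈-allFin u)) ⟩
    maxDegree G                                         ∎)
    where
    open ≤-Reasoning
    𝟙-true : ∀ b → 𝟙 (b Bool.≟ true) ≡ (if b then 1 else 0)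
    𝟙-true true  = refl
    𝟙-true false = refl

  Separates : (Fin n → ℕ) → Fin n → Fin n → Set
  Separates p u v = ∀ w → w ∈ N[ u ] → p w < p v

  boxRep : ∀ {K} (p : Fin K → Fin n → ℕ) →
           (∀ u v → v ∉ N[ u ] → ∃[ i ] Separates (p i) u v) → BoxRep G K
  boxRep p separated = record
    { lo       = λ v i → p i v
    ; hi       = λ v i → maximum (map (p i) N[ v ])
    ; nonempty = λ v i → reaches i (here refl)
    ; correct  = λ u v u≢v → mk⇔
        (λ uv i → reaches i (N-sym (N-adjacent uv)) , reaches i (N-adjacent uv))
        (λ meet → adjacent u v u≢v meet (adjacent? u v))
    }
    where
    reaches : ∀ i {u w} → w ∈ N[ u ] → p i w ≤ maximum (map (p i) N[ u ])
    reaches i w∈ = ∈⇒≤maximum (∈-map⁺ (p i) w∈)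
    adjacent : ∀ u v → u ≢ v →
      (∀ i → (p i u ≤ maximum (map (p i) N[ v ])) × (p i v ≤ maximum (map (p i) N[ u ]))) →
      Dec (adj G u v ≡ true) → adj G u v ≡ true
    adjacent u v u≢v meet (yes uv) = uv
    adjacent u v u≢v meet (no ¬uv) =
      let i , sep = separated u v v∉N
      -- `maximum` starts from 0, so bounding it also requires `p i v` to be positive, which follows
      -- from separation at `u` itself.
      in contradiction (proj₂ (meet i)) (<⇒≱ (maximum-map-< (p i) N[ u ] (≤-<-trans z≤n (sep u (here refl))) (sep _)))
      where
      v∉N : v ∉ N[ u ]
      v∉N (here eq)  = u≢v (sym eq)
      v∉N (there v∈) = ¬uv (proj₂ (∈-filter⁻ (adjacent? u) {xs = allFin n} v∈))

  -- Ranking by a vertex order and its reverse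

  -- Both rankings are shifted by one to keep 0 for the vertices that `restrict` discards.
  rank : Fin 2 → Fin n → ℕ
  rank zero       w = suc (toℕ w)
  rank (suc zero) w = suc (n ∸ toℕ w)

  rank>0 : ∀ b w → 0 < rank b w
  rank>0 zero       w = z<s
  rank>0 (suc zero) w = z<s

  rank-< : ∀ {v w} → w ≢ v → ∃[ b ] rank b w < rank b v
  rank-< {v} {w} w≢v with <-cmp (toℕ w) (toℕ v)
  ... | tri< w<v _ _ = zero , s≤s w<v
  ... | tri≈ _ eq _  = contradiction (Fin.toℕ-injective eq) w≢v
  ... | tri> _ _ v<w = suc zero , s≤s (∸-monoʳ-< v<w (<⇒≤ (Fin.toℕ<n w)))

  restrict : (Fin n → ℕ) → {R : Fin n → Set} → (∀ w → Dec (R w)) → Fin n → ℕ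
  restrict p R? w with R? w
  ... | yes _ = p w
  ... | no  _ = 0

  restrict-separates : ∀ p {R : Fin n → Set} (R? : ∀ w → Dec (R w)) {u v} → R v → 0 < p v →
    (∀ {w} → w ∈ N[ u ] → R w → p w < p v) → Separates (restrict p R?) u v
  restrict-separates p R? {u} {v} Rv 0<pv below w w∈ with R? v | R? w
  ... | no ¬Rv | _      = contradiction Rv ¬Rv
  ... | yes _  | no _   = 0<pv
  ... | yes _  | yes Rw = below w∈ Rw

  rank-separates : ∀ {C : Set} (_≟_ : (x y : C) → Dec (x ≡ y)) (χ : Fin n → C) {R : Fin n → Set} (R? : ∀ w → Dec (R w)) {u v} →
    (∀ {w w′} → w ∈ N[ u ] → w′ ∈ N[ u ] → χ w ≡ χ w′ → w ≡ w′) →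
    R v → (∀ {w} → w ∈ N[ u ] → R w → χ w ≡ χ v) → v ∉ N[ u ] →
    ∃[ b ] Separates (restrict (rank b) R?) u v
  rank-separates _≟_ χ {R} R? {u} {v} inj Rv only v∉ = cases (Any.any? (λ w → χ w ≟ χ v) N[ u ])
    where
    cases : Dec (Any (λ w → χ w ≡ χ v) N[ u ]) → ∃[ b ] Separates (restrict (rank b) R?) u v
    -- Without a rival in `N[ u ]` either direction works, since ranks are positive.
    cases (no none) = zero , restrict-separates (rank zero) {R} R? {u} {v} Rv (rank>0 zero v)
      λ {w} w∈ Rw → contradiction (Any.map (λ { refl → only w∈ Rw }) w∈) none
    cases (yes some) =
      let w₀ , w₀∈ , eq₀ = find some
          b , lt = rank-< λ w₀≡v → v∉ (subst (_∈ N[ u ]) w₀≡v w₀∈)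
      in b , restrict-separates (rank b) {R} R? {u} {v} Rv (rank>0 b v)
        λ w∈ Rw → subst (λ w → rank b w < rank b v) (sym (inj w∈ w₀∈ (trans (only w∈ Rw) (sym eq₀)))) lt

  -- Vertices sharing a closed neighbourhood are within distance two, hence in conflict; each vertex
  -- has at most `D * D` conflicts, counted with repetition.
  distance-2-colouring : ∀ {D} → (∀ u → length N[ u ] ≤ D) →
    ∃ λ (χ : Fin n → Fin (suc (D * D))) → ∀ {u w w′} → w ∈ N[ u ] → w′ ∈ N[ u ] → χ w ≡ χ w′ → w ≡ w′
  distance-2-colouring N≤D =
    let χ , proper = proper-colouring N² N²-sym (λ v → length-concatMap-≤ N[_] N[ v ] (N≤D v) N≤D)
    in χ , λ {u} {w} {w′} w∈ w′∈ eq → decidable-stable (w Fin.≟ w′) λ w≢w′ → proper w w′ (N²⁺ w∈ w′∈) (w≢w′ ∘ sym) eq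
    where
    N² : Fin n → List (Fin n)
    N² v = concatMap N[_] N[ v ]
    N²⁺ : ∀ {u v w} → v ∈ N[ u ] → w ∈ N[ u ] → w ∈ N² v
    N²⁺ v∈ w∈ = ∈-concatMap⁺ N[_] (Any.map (λ { refl → w∈ }) (N-sym v∈))
    N²-sym : ∀ {v w} → w ∈ N² v → v ∈ N² w
    N²-sym {v} w∈ = let u , u∈ , w∈u = find (∈-concatMap⁻ N[_] {xs = N[ v ]} w∈) in N²⁺ w∈u (N-sym u∈)

  -- Combining parts, hash maps, hash values and directions

  module _ {m t k N : ℕ}
    (f : Vec (Fin m) n) (f-frugal : ∀ u a → length (filter (λ w → lookup f w Fin.≟ a) N[ u ]) ≤ k)
    (χ : Fin n → Fin N) (χ-inj : ∀ {u w w′} → w ∈ N[ u ] → w′ ∈ N[ u ] → χ w ≡ χ w′ → w ≡ w′)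
    (gs : Vec (Vec (Fin (2 * k)) N) t)
    (gs-separate : ∀ c S → length S ≤ k → ∃[ j ] (∀ {s} → s ∈ S → s ≢ c → lookup (lookup gs j) s ≢ lookup (lookup gs j) c))
    where

    hash : Fin t → Fin n → Fin (2 * k)
    hash j w = lookup (lookup gs j) (χ w)

    class? : ∀ i j a w → Dec (lookup f w ≡ i × hash j w ≡ a)
    class? i j a w = (lookup f w Fin.≟ i) ×-dec (hash j w Fin.≟ a)

    q : Fin m × Fin t × Fin (2 * k) × Fin 2 → Fin n → ℕ
    q (i , j , a , b) = restrict (rank b) (class? i j a)

    p : Fin (m * (t * (2 * k * 2))) → Fin n → ℕ
    p x = q (decode x)

    separated : ∀ u v → v ∉ N[ u ] → ∃[ x ] Separates (p x) u v
    separated u v v∉ = encode (i , j , hash j v , proj₁ ranked)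
                     , subst (λ x → Separates (q x) u v) (sym (decode-encode (i , j , hash j v , proj₁ ranked))) (proj₂ ranked)
      where
      i = lookup f v
      near = filter (λ w → lookup f w Fin.≟ i) N[ u ]
      -- Frugality bounds `near` by `k`, so one hash map tells `χ v` from every other colour
      -- occurring there.
      chosen = gs-separate (χ v) (map χ near) (≤-trans (≤-reflexive (length-map χ near)) (f-frugal u i))
      j = proj₁ chosen
      only : ∀ {w} → w ∈ N[ u ] → lookup f w ≡ i × hash j w ≡ hash j v → χ w ≡ χ v
      only {w} w∈ (fw , hw) = decidable-stable (χ w Fin.≟ χ v) λ χw≢χv →
        proj₂ chosen (∈-map⁺ χ (∈-filter⁺ (λ w → lookup f w Fin.≟ i) w∈ fw)) χw≢χv hw
      ranked = rank-separates Fin._≟_ χ (class? i j (hash j v)) χ-inj (refl , refl) only v∉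

    combined-boxRep : BoxRep G (m * (t * (2 * k * 2)))
    combined-boxRep = boxRep p separated

  boxRep-dimension : ∀ {D m k t} .{{_ : NonZero m}} .{{_ : NonZero k}} → (∀ u → length N[ u ] ≤ D) →
    16 * D ≤ m * suc k → 16 * (D * D) ≤ 2 ^ k → suc (D * D) ^ suc k < 2 ^ t → BoxRep G (m * (t * (2 * k * 2)))
  boxRep-dimension {D} {m} {k} {t} N≤D m-large k-large t-large =
    let f , f-frugal     = frugal-colouring N[_] N-unique N-sym N≤D {m} {k} m-large k-large
        χ , χ-inj        = distance-2-colouring N≤D
        gs , gs-separate = hash-family {suc (D * D)} {k} {t} t-large
    in combined-boxRep {m} {t} {k} f f-frugal χ χ-inj gs gs-separate

-- The choice of parameters

n<2^n : ∀ n → n < 2 ^ n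
n<2^n zero    = ≤-refl
n<2^n (suc n) = ≤-trans (+-mono-≤ (m^n>0 2 n) (n<2^n n)) (+-monoʳ-≤ (2 ^ n) (m≤m+n (2 ^ n) 0))

-- Otherwise monotonicity would make the logarithm of `n` at least its own successor.
n<2^[1+⌊log₂n⌋] : ∀ n → n < 2 ^ suc ⌊log₂ n ⌋
n<2^[1+⌊log₂n⌋] n = ≰⇒> λ le → 1+n≰n (≤-trans (≤-reflexive (sym (⌊log₂[2^n]⌋≡n (suc ⌊log₂ n ⌋)))) (⌊log₂⌋-mono-≤ le))

⌊log₂n⌋≤n : ∀ n → ⌊log₂ n ⌋ ≤ n
⌊log₂n⌋≤n n = ≤-trans (⌊log₂⌋-mono-≤ (<⇒≤ (n<2^n n))) (≤-reflexive (⌊log₂[2^n]⌋≡n n))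

n<[1+n/d]*d : ∀ n d .{{_ : NonZero d}} → n < suc (n / d) * d
n<[1+n/d]*d n d = begin-strict
  n                      ≡⟨ m≡m%n+[m/n]*n n d ⟩
  n % d + n / d * d      <⟨ +-monoˡ-< (n / d * d) (m%n<n n d) ⟩
  d + n / d * d          ∎
  where open ≤-Reasoning

module Parameters (Δ L : ℕ) (1≤L : 1 ≤ L) (L≤Δ : L ≤ Δ) (Δ<2^[1+L] : Δ < 2 ^ suc L) where
  D k M t : ℕ
  D = suc Δ
  -- Since `D * D` is at most `4 * 2 ^ (L + L)`, the summand 6 covers the factor 64 in
  -- `16 * (D * D)`.
  k = 6 + (L + L)
  M = suc (16 * D / suc k)
  -- The number of colours is at most `2 ^ (3 + (L + L))`; the successor makes `t-large` strict.
  t = suc ((3 + (L + L)) * suc k)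

  1≤Δ : 1 ≤ Δ
  1≤Δ = ≤-trans 1≤L L≤Δ

  M-large : 16 * D ≤ M * suc k
  M-large = <⇒≤ (n<[1+n/d]*d (16 * D) (suc k))

  D*D≤ : D * D ≤ 4 * 2 ^ (L + L)
  D*D≤ = begin
    D * D                            ≤⟨ *-mono-≤ Δ<2^[1+L] Δ<2^[1+L] ⟩
    2 * 2 ^ L * (2 * 2 ^ L)          ≡⟨ [m*n]*[o*p]≡[m*o]*[n*p] 2 (2 ^ L) 2 (2 ^ L) ⟩
    4 * (2 ^ L * 2 ^ L)              ≡⟨ cong (4 *_) (sym (^-distribˡ-+-* 2 L L)) ⟩
    4 * 2 ^ (L + L)                  ∎
    where open ≤-Reasoning

  k-large : 16 * (D * D) ≤ 2 ^ k
  k-large = begin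
    16 * (D * D)               ≤⟨ *-monoʳ-≤ 16 D*D≤ ⟩
    16 * (4 * 2 ^ (L + L))     ≡⟨ sym (*-assoc 16 4 (2 ^ (L + L))) ⟩
    64 * 2 ^ (L + L)           ≡⟨ sym (^-distribˡ-+-* 2 6 (L + L)) ⟩
    2 ^ k                      ∎
    where open ≤-Reasoning

  t-large : suc (D * D) ^ suc k < 2 ^ t
  t-large = begin-strict
    suc (D * D) ^ suc k                   ≤⟨ ^-monoˡ-≤ (suc k) base ⟩
    (2 ^ (3 + (L + L))) ^ suc k           ≡⟨ ^-*-assoc 2 (3 + (L + L)) (suc k) ⟩
    2 ^ ((3 + (L + L)) * suc k)           <⟨ ^-monoʳ-< 2 (s≤s (s≤s z≤n)) (n<1+n ((3 + (L + L)) * suc k)) ⟩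
    2 ^ t                                 ∎
    where
    open ≤-Reasoning
    base : suc (D * D) ≤ 2 ^ (3 + (L + L))
    base = begin
      1 + D * D                                ≤⟨ +-mono-≤ (≤-trans (m^n>0 2 (L + L)) (m≤n*m (2 ^ (L + L)) 4)) D*D≤ ⟩
      4 * 2 ^ (L + L) + 4 * 2 ^ (L + L)        ≡⟨ sym (*-distribʳ-+ (2 ^ (L + L)) 4 4) ⟩
      8 * 2 ^ (L + L)                          ≡⟨ sym (^-distribˡ-+-* 2 3 (L + L)) ⟩
      2 ^ (3 + (L + L))                        ∎

  -- Used to absorb additive constants into multiples of `L`.
  scale : ∀ c → c ≤ c * L
  scale c = m≤m*n c L {{>-nonZero 1≤L}}

  1+k≤9L : suc k ≤ 9 * L
  1+k≤9L = begin
    7 + (L + L)          ≤⟨ +-monoˡ-≤ (L + L) (scale 7) ⟩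
    7 * L + (L + L)      ≡⟨ collect L ⟩
    9 * L                ∎
    where
    open ≤-Reasoning
    collect : ∀ l → 7 * l + (l + l) ≡ 9 * l
    collect = solve-∀

  -- The factor `k` from the hash values cancels the denominator of `M`, so the product is linear in
  -- `Δ`. Rounding up contributes 9, and `16 * D` at most 32.
  M*k≤41Δ : M * k ≤ 41 * Δ
  M*k≤41Δ = begin
    M * k                                     ≤⟨ *-monoʳ-≤ M (n≤1+n k) ⟩
    suc k + 16 * D / suc k * suc k            ≤⟨ +-mono-≤ (≤-trans 1+k≤9L (*-monoʳ-≤ 9 L≤Δ)) (m/n*n≤m (16 * D) (suc k)) ⟩
    9 * Δ + 16 * (1 + Δ)                      ≤⟨ +-monoʳ-≤ (9 * Δ) (*-monoʳ-≤ 16 (+-monoˡ-≤ Δ 1≤Δ)) ⟩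
    9 * Δ + 16 * (Δ + Δ)                      ≡⟨ collect Δ ⟩
    41 * Δ                                    ∎
    where
    open ≤-Reasoning
    collect : ∀ d → 9 * d + 16 * (d + d) ≡ 41 * d
    collect = solve-∀

  t≤46L² : t ≤ 46 * (L * L)
  t≤46L² = begin
    1 + (3 + (L + L)) * suc k                    ≤⟨ +-mono-≤ (*-mono-≤ 1≤L 1≤L) (*-mono-≤ (+-monoˡ-≤ (L + L) (scale 3)) 1+k≤9L) ⟩
    L * L + (3 * L + (L + L)) * (9 * L)          ≡⟨ collect L ⟩
    46 * (L * L)                                 ∎
    where
    open ≤-Reasoning
    collect : ∀ l → l * l + (3 * l + (l + l)) * (9 * l) ≡ 46 * (l * l)
    collect = solve-∀

  -- The 4 combines the two directions with the 2 in `2 * k`; the successor in the constant makes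
  -- the inequality strict.
  dimension-bound : M * (t * (2 * k * 2)) < suc (4 * 41 * 46) * Δ * L ^ 2
  dimension-bound = begin-strict
    M * (t * (2 * k * 2))                       ≡⟨ regroup M t k ⟩
    4 * (M * k) * t                             ≤⟨ *-mono-≤ (*-monoʳ-≤ 4 M*k≤41Δ) t≤46L² ⟩
    4 * (41 * Δ) * (46 * (L * L))               ≡⟨ factor 4 41 46 Δ (L * L) ⟩
    4 * 41 * 46 * (Δ * (L * L))                 <⟨ *-monoˡ-< (Δ * (L * L)) {{>-nonZero (*-mono-≤ 1≤Δ (*-mono-≤ 1≤L 1≤L))}} (n<1+n (4 * 41 * 46)) ⟩
    suc (4 * 41 * 46) * (Δ * (L * L))           ≡⟨ sym (*-assoc (suc (4 * 41 * 46)) Δ (L * L)) ⟩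
    suc (4 * 41 * 46) * Δ * (L * L)             ≡⟨ cong (λ l → suc (4 * 41 * 46) * Δ * (L * l)) (sym (*-identityʳ L)) ⟩
    suc (4 * 41 * 46) * Δ * L ^ 2               ∎
    where
    open ≤-Reasoning
    regroup : ∀ m t k → m * (t * (2 * k * 2)) ≡ 4 * (m * k) * t
    regroup = solve-∀
    factor : ∀ a b c x y → a * (b * x) * (c * y) ≡ a * b * c * (x * y)
    factor = solve-∀

theorem4 : ∃[ c ] (0 < c × (∀ (n : ℕ) (G : Graph n) → 2 ≤ maxDegree G →
    BoxicityLessThan G (c * maxDegree G * (⌊log₂ maxDegree G ⌋ ^ 2))))
theorem4 = suc (4 * 41 * 46) , z<s , λ n G 2≤Δ →
  let Δ = maxDegree G
      1≤L = ≤-trans (≤-reflexive (sym (⌊log₂[2^n]⌋≡n 1))) (⌊log₂⌋-mono-≤ 2≤Δ)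
      open Parameters Δ ⌊log₂ Δ ⌋ 1≤L (⌊log₂n⌋≤n Δ) (n<2^[1+⌊log₂n⌋] Δ)
  in M * (t * (2 * k * 2)) , dimension-bound , boxRep-dimension G {D} {M} {k} {t} (N-length G) M-large k-large t-large
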